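{- For every primitive-recursive step function $f$ (whether or not its search is total), $\emptyset\vdash(\mathcal A\cdot\mathrm{rrep}(f))\,\mathsf B$ is derivable in OGA.
   Context: **Syntax.** Terms: $t::=v_i\mid\bot\mid\mathbf 0\mid\mathbf S t\mid t=t\mid\neg t\mid t\lor t\mid\lambda t\mid t\cdot t\mid\mathcal R\mid\mathcal A$ ($v_i$, $i\in\mathbb N$, de Bruijn variables; $\lambda$ is the only binder; application associates to the left). A term is well-formed (wf) if generated by this grammar. $\bot$ is a divergent constant, $\mathcal R$ the primitive recursor, $\mathcal A$ the universal quantifier. Abbreviations: $t\,\mathsf N$ is $t=t$; $t\,\mathsf B$ is $t\lor\neg t$; $t\ne u$ is $\neg(t=u)$; $t\land u$ is $\neg(\neg t\lor\neg u)$; $t\to u$ is $\neg t\lor u$; $\underline n=\mathbf S^n\mathbf 0$. $\uparrow$ shifts all free indices up by one; $b[t]$ is the $\beta$-instance substituting $t$ for the outermost bound variable of $b$; $[v\mapsto s]$ is capture-avoiding substitution for a free variable; $\mathrm{fv}$ is the set of free variables. **Head steps** $\triangleright$: $(\lambda b)\cdot t\triangleright b[t]$; $\mathcal R\cdot g\cdot h\cdot\mathbf 0\triangleright g$; $\mathcal R\cdot g\cdot h\cdot(\mathbf S\underline n)\triangleright h\cdot\underline n\cdot(\mathcal R\cdot g\cdot h\cdot\underline n)$; if $t\triangleright t'$ then $t\cdot u\triangleright t'\cdot u$. **Rules.** Judgments are $\Gamma\vdash c$, $\Gamma$ a finite set of wf terms, $c$ a wf term (all terms in rules are wf). A proof is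 a finite list of judgments each following from earlier entries by one rule; $\Gamma\vdash c$ is derivable if it occurs in a proof. Rules ("$\Rightarrow$" from premises to conclusion, "$\Leftrightarrow$" both directions; $\Gamma$ is the context of a judgment when none is shown): $\Gamma,c\vdash c$; $\Gamma\vdash c\Rightarrow\Gamma,a\vdash c$; $\Gamma\vdash a$ and $\Gamma,a\vdash c\Rightarrow\Gamma\vdash c$; $\Gamma\vdash c\Rightarrow[v\mapsto s]\Gamma\vdash[v\mapsto s]c$; $\vdash a\Leftrightarrow\ \vdash a=\underline1$; $\vdash\neg a\Leftrightarrow\ \vdash a=\underline0$; $\vdash\neg a,\ \vdash a\Rightarrow\ \vdash c$; $\vdash a\Leftrightarrow\ \vdash\neg\neg a$; $\vdash a\Rightarrow\ \vdash a\lor b$; $\vdash b\Rightarrow\ \vdash a\lor b$; $\vdash\neg a,\ \vdash\neg b\Rightarrow\ \vdash\neg(a\lor b)$; $\vdash a\lor b,\ \Gamma,a\vdash c,\ \Gamma,b\vdash c\Rightarrow\ \vdash c$; $\vdash\neg(a\lor b)\Rightarrow\ \vdash\neg a$; $\vdash\neg(a\lor b)\Rightarrow\ \vdash\neg b$; $\vdash a\,\mathsf N\Leftrightarrow\ \vdash a=a$; $\vdash a=b\Rightarrow\ \vdash b=a$; $\vdash a=b,\ \vdash[v\mapsto a]p\Rightarrow\ \vdash[v\mapsto b]p$; $\vdash a\ne b\Rightarrow\ \vdash b\ne a$; $\vdash a\,\mathsf N,\ \vdash b\,\mathsf N\Rightarrow\ \vdash(a=b)\,\mathsf B$; $\vdash(a=b)\,\mathsf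 B\Rightarrow\ \vdash(a\,\mathsf N)\land(b\,\mathsf N)$; $\vdash\mathbf 0\,\mathsf N$; $\vdash a\,\mathsf N\Leftrightarrow\ \vdash(\mathbf S a)\,\mathsf N$; $\vdash a\,\mathsf N\Rightarrow\ \vdash\mathbf S a\ne\mathbf 0$; $\vdash a\ne b\Leftrightarrow\ \vdash\mathbf S a\ne\mathbf S b$; $\vdash\mathbf S a=\mathbf S b\Rightarrow\ \vdash a=b$; $\vdash\bot\,\mathsf N\Rightarrow\ \vdash p$; induction: $\vdash[v_i\mapsto\mathbf 0]c$, $\ v_i\,\mathsf N,c,\Gamma\vdash[v_i\mapsto\mathbf S v_i]c$, $\ \vdash a\,\mathsf N\Rightarrow\ \vdash[v_i\mapsto a]c$ if $v_i\notin\mathrm{fv}(\Gamma)$; conversion, for $c\triangleright c'$: $\vdash c'\Rightarrow\ \vdash c$; $\vdash c\Rightarrow\ \vdash c'$; $\vdash\neg c\Rightarrow\ \vdash\neg c'$; $\vdash c'\,\mathsf N\Rightarrow\ \vdash c=c'$; $\vdash m\,\mathsf N,\ \vdash(h\cdot m\cdot(\mathcal R\cdot g\cdot h\cdot m))\,\mathsf N\Rightarrow\ \vdash\mathcal R\cdot g\cdot h\cdot(\mathbf S m)=h\cdot m\cdot(\mathcal R\cdot g\cdot h\cdot m)$; $v_0\,\mathsf N,\uparrow\Gamma\vdash\uparrow f\cdot v_0\Rightarrow\Gamma\vdash\mathcal A\cdot f$; $\vdash\mathcal A\cdot f,\ \vdash a\,\mathsf N\Rightarrow\ \vdash f\cdot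 a$; $\vdash\neg(f\cdot a),\ \vdash a\,\mathsf N\Rightarrow\ \vdash\neg(\mathcal A\cdot f)$; $\Gamma\vdash\neg(\mathcal A\cdot f)$ and $v_0\,\mathsf N,\neg(\uparrow f\cdot v_0),\uparrow\Gamma\vdash\uparrow c\Rightarrow\Gamma\vdash c$. These are the rules of RGA. OGA has these and the rule ATI: $\Gamma\vdash\mathcal A\cdot(\lambda((\uparrow u\cdot v_0)\,\mathsf B))\Rightarrow\Gamma\vdash(\mathcal A\cdot u)\,\mathsf B$. **Search sentences.** A step function is a primitive recursive $f:\mathbb N^2\to\mathbb N$ presented by a primitive recursive definition (from zero, successor, projections by composition and primitive recursion). Its search at $n$ hits at step $k$ if $f(n,k)\neq0$, and hits if it hits at some step. $\mathrm{cmp}(f)$ is the closed term obtained by compiling the definition into curried $\lambda$-terms: zero functions to $\lambda\cdots\lambda\,\mathbf 0$, successor to $\lambda\,\mathbf S v_0$, projections to $\lambda\cdots\lambda\,v_i$, composition to the corresponding applications, and $F(0,\vec x)=G(\vec x)$, $F(m+1,\vec x)=H(m,F(m,\vec x),\vec x)$ to the curried term sending $y,\vec x$ to $\mathcal R\cdot(\mathrm{cmp}(G)\cdot\vec x)\cdot(\lambda\lambda\,\mathrm{cmp}(H)\cdot v_1\cdot v_0\cdot\vec x)\cdot y$ (indices of $\vec x$ shifted under the $\lambda$s). Put $\mathrm{rmat}(f,n)=\lambda(\mathrm{cmp}(f)\cdot\underline n\cdot v_0=\mathbf 0)$ and $\mathrm{rrep}(f)=\lambda\,\neg(\mathcal A\cdot\lambda(\mathrm{cmp}(f)\cdot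 v_1\cdot v_0=\mathbf 0))$. So $\mathrm{rrep}(f)\cdot\underline n\triangleright\neg(\mathcal A\cdot\mathrm{rmat}(f,n))$ expresses that the search of $f$ at $n$ hits, and $\mathcal A\cdot\mathrm{rrep}(f)$ that it hits at every $n$. -}

module Defs where

open import Data.Empty using (⊥)
open import Data.Bool using (if_then_else_)
open import Data.Fin using (Fin; toℕ; opposite)
open import Data.List using (List; []; _∷_; map; foldl; applyDownFrom)
open import Data.List.Membership.Propositional using (_∈_)
open import Data.List.Relation.Binary.BagAndSetEquality using (_∼[_]_; set)
open import Data.List.Relation.Unary.All using (All)
open import Data.Nat using (ℕ; zero; suc; _+_; _≡ᵇ_)
open import Data.Product using (_×_; ∃)
open import Data.Sum using (_⊎_)
open import Data.Vec as Vec using (Vec; []; _∷_)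
open import Function using (_∘_)
open import Relation.Binary.PropositionalEquality using (_≡_)
open import Relation.Nullary using (¬_)

infix  3 _⊢_
infixr 11 ƛ_
infixl 12 _∨̇_
infixl 13 _∧̇_
infixr 14 ¬̇_
infix  15 _≐_ _≠_
infix  16 _𝖭 _𝖡
infixr 17 𝐒_
infixl 18 _·_

-- A term is well-formed when the grammar generates it, so every inhabitant of
-- Term is well-formed.  Indices are unbounded: terms need not be closed.
data Term : Set where
  v    : ℕ → Term
  ⊥̇    : Term
  𝟎    : Term
  𝐒_   : Term → Term
  _≐_  : Term → Term → Term
  ¬̇_   : Term → Term
  _∨̇_  : Term → Term → Term
  ƛ_   : Term → Term
  _·_  : Term → Term → Term
  𝓡    : Term
  𝓐    : Term

_𝖭 _𝖡 : Term → Term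
t 𝖭 = t ≐ t
t 𝖡 = t ∨̇ (¬̇ t)

_≠_ _∧̇_ : Term → Term → Term
t ≠ u  = ¬̇ (t ≐ u)
t ∧̇ u  = ¬̇ ((¬̇ t) ∨̇ (¬̇ u))

num : ℕ → Term
num zero    = 𝟎
num (suc n) = 𝐒 (num n)

liftRen : (ℕ → ℕ) → ℕ → ℕ
liftRen ρ zero    = zero
liftRen ρ (suc i) = suc (ρ i)

rename : (ℕ → ℕ) → Term → Term
rename ρ (v i)    = v (ρ i)
rename ρ ⊥̇        = ⊥̇
rename ρ 𝟎        = 𝟎
rename ρ (𝐒 t)    = 𝐒 (rename ρ t)
rename ρ (t ≐ u)  = rename ρ t ≐ rename ρ u
rename ρ (¬̇ t)    = ¬̇ (rename ρ t)
rename ρ (t ∨̇ u)  = rename ρ t ∨̇ rename ρ u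
rename ρ (ƛ b)    = ƛ (rename (liftRen ρ) b)
rename ρ (t · u)  = rename ρ t · rename ρ u
rename ρ 𝓡        = 𝓡
rename ρ 𝓐        = 𝓐

↑ : Term → Term
↑ = rename suc

liftSub : (ℕ → Term) → ℕ → Term
liftSub σ zero    = v zero
liftSub σ (suc i) = ↑ (σ i)

-- Simultaneous capture-avoiding substitution of σ i for each free v i.
subst : (ℕ → Term) → Term → Term
subst σ (v i)    = σ i
subst σ ⊥̇        = ⊥̇
subst σ 𝟎        = 𝟎
subst σ (𝐒 t)    = 𝐒 (subst σ t)
subst σ (t ≐ u)  = subst σ t ≐ subst σ u
subst σ (¬̇ t)    = ¬̇ (subst σ t)
subst σ (t ∨̇ u)  = subst σ t ∨̇ subst σ u
subst σ (ƛ b)    = ƛ (subst (liftSub σ) b)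
subst σ (t · u)  = subst σ t · subst σ u
subst σ 𝓡        = 𝓡
subst σ 𝓐        = 𝓐

-- Replaces v i only; unlike β-instantiation it renumbers no other variable.
[_↦_]_ : ℕ → Term → Term → Term
[ i ↦ s ] t = subst (λ j → if j ≡ᵇ i then s else v j) t

βsub : Term → ℕ → Term
βsub t zero    = t
βsub t (suc i) = v i

_[_] : Term → Term → Term
b [ t ] = subst (βsub t) b

_∈fv_ : ℕ → Term → Set
i ∈fv v j      = i ≡ j
i ∈fv ⊥̇        = ⊥
i ∈fv 𝟎        = ⊥
i ∈fv (𝐒 t)    = i ∈fv t
i ∈fv (t ≐ u)  = i ∈fv t ⊎ i ∈fv u
i ∈fv (¬̇ t)    = i ∈fv t
i ∈fv (t ∨̇ u)  = i ∈fv t ⊎ i ∈fv u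
i ∈fv (ƛ b)    = suc i ∈fv b
i ∈fv (t · u)  = i ∈fv t ⊎ i ∈fv u
i ∈fv 𝓡        = ⊥
i ∈fv 𝓐        = ⊥

infix 4 _▷_

data _▷_ : Term → Term → Set where
  β    : ∀ {b t} → (ƛ b) · t ▷ b [ t ]
  rec0 : ∀ {g h} → 𝓡 · g · h · 𝟎 ▷ g
  recS : ∀ {g h} n →
         𝓡 · g · h · (𝐒 (num n)) ▷ h · num n · (𝓡 · g · h · num n)
  appˡ : ∀ {t t′ u} → t ▷ t′ → t · u ▷ t′ · u

-- Contexts are finite sets, represented by lists; the list representation is
-- made irrelevant by the rule `set≈` below.
Context : Set
Context = List Term

data Judgement : Set where
  _⊢_ : Context → Term → Judgement

-- A rule system relates the premises of each rule instance to its conclusion.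
RuleSystem : Set₁
RuleSystem = List Judgement → Judgement → Set

private
  variable
    Γ Δ : Context
    a b c c′ f g h m p s u : Term

data RGA : RuleSystem where
  -- Not a rule of the calculus: identifies lists with the same elements.
  set≈ : Γ ∼[ set ] Δ → RGA ((Γ ⊢ c) ∷ []) (Δ ⊢ c)

  hyp    : RGA [] (c ∷ Γ ⊢ c)
  weaken : RGA ((Γ ⊢ c) ∷ []) (a ∷ Γ ⊢ c)
  cut    : RGA ((Γ ⊢ a) ∷ (a ∷ Γ ⊢ c) ∷ []) (Γ ⊢ c)
  inst   : ∀ i s → RGA ((Γ ⊢ c) ∷ []) (map ([ i ↦ s ]_) Γ ⊢ [ i ↦ s ] c)

  true⇒≐1  : RGA ((Γ ⊢ a) ∷ []) (Γ ⊢ a ≐ num 1)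
  ≐1⇒true  : RGA ((Γ ⊢ a ≐ num 1) ∷ []) (Γ ⊢ a)
  false⇒≐0 : RGA ((Γ ⊢ ¬̇ a) ∷ []) (Γ ⊢ a ≐ num 0)
  ≐0⇒false : RGA ((Γ ⊢ a ≐ num 0) ∷ []) (Γ ⊢ ¬̇ a)

  contra : RGA ((Γ ⊢ ¬̇ a) ∷ (Γ ⊢ a) ∷ []) (Γ ⊢ c)
  ¬¬I    : RGA ((Γ ⊢ a) ∷ []) (Γ ⊢ ¬̇ ¬̇ a)
  ¬¬E    : RGA ((Γ ⊢ ¬̇ ¬̇ a) ∷ []) (Γ ⊢ a)

  ∨I₁  : RGA ((Γ ⊢ a) ∷ []) (Γ ⊢ a ∨̇ b)
  ∨I₂  : RGA ((Γ ⊢ b) ∷ []) (Γ ⊢ a ∨̇ b)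
  ∨I₃  : RGA ((Γ ⊢ ¬̇ a) ∷ (Γ ⊢ ¬̇ b) ∷ []) (Γ ⊢ ¬̇ (a ∨̇ b))
  ∨E₁  : RGA ((Γ ⊢ a ∨̇ b) ∷ (a ∷ Γ ⊢ c) ∷ (b ∷ Γ ⊢ c) ∷ []) (Γ ⊢ c)
  ∨E₂  : RGA ((Γ ⊢ ¬̇ (a ∨̇ b)) ∷ []) (Γ ⊢ ¬̇ a)
  ∨E₃  : RGA ((Γ ⊢ ¬̇ (a ∨̇ b)) ∷ []) (Γ ⊢ ¬̇ b)

  𝖭⇒≐    : RGA ((Γ ⊢ a 𝖭) ∷ []) (Γ ⊢ a ≐ a)
  ≐⇒𝖭    : RGA ((Γ ⊢ a ≐ a) ∷ []) (Γ ⊢ a 𝖭)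
  ≐-sym  : RGA ((Γ ⊢ a ≐ b) ∷ []) (Γ ⊢ b ≐ a)
  ≐-repl : ∀ i p → RGA ((Γ ⊢ a ≐ b) ∷ (Γ ⊢ [ i ↦ a ] p) ∷ []) (Γ ⊢ [ i ↦ b ] p)
  ≠-sym  : RGA ((Γ ⊢ a ≠ b) ∷ []) (Γ ⊢ b ≠ a)
  ≐-𝖡    : RGA ((Γ ⊢ a 𝖭) ∷ (Γ ⊢ b 𝖭) ∷ []) (Γ ⊢ (a ≐ b) 𝖡)
  ≐-𝖡⁻   : RGA ((Γ ⊢ (a ≐ b) 𝖡) ∷ []) (Γ ⊢ (a 𝖭) ∧̇ (b 𝖭))

  0𝖭     : RGA [] (Γ ⊢ 𝟎 𝖭)
  S𝖭I    : RGA ((Γ ⊢ a 𝖭) ∷ []) (Γ ⊢ (𝐒 a) 𝖭)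
  S𝖭E    : RGA ((Γ ⊢ (𝐒 a) 𝖭) ∷ []) (Γ ⊢ a 𝖭)
  S≠0    : RGA ((Γ ⊢ a 𝖭) ∷ []) (Γ ⊢ 𝐒 a ≠ 𝟎)
  S≠I    : RGA ((Γ ⊢ a ≠ b) ∷ []) (Γ ⊢ 𝐒 a ≠ 𝐒 b)
  S≠E    : RGA ((Γ ⊢ 𝐒 a ≠ 𝐒 b) ∷ []) (Γ ⊢ a ≠ b)
  S≐E    : RGA ((Γ ⊢ 𝐒 a ≐ 𝐒 b) ∷ []) (Γ ⊢ a ≐ b)
  ⊥𝖭E    : RGA ((Γ ⊢ ⊥̇ 𝖭) ∷ []) (Γ ⊢ p)

  ind : ∀ i c → All (λ t → ¬ (i ∈fv t)) Γ →
        RGA ((Γ ⊢ [ i ↦ 𝟎 ] c)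
             ∷ (v i 𝖭 ∷ c ∷ Γ ⊢ [ i ↦ 𝐒 (v i) ] c)
             ∷ (Γ ⊢ a 𝖭) ∷ [])
            (Γ ⊢ [ i ↦ a ] c)

  conv-exp : c ▷ c′ → RGA ((Γ ⊢ c′) ∷ []) (Γ ⊢ c)
  conv-red : c ▷ c′ → RGA ((Γ ⊢ c) ∷ []) (Γ ⊢ c′)
  conv-¬   : c ▷ c′ → RGA ((Γ ⊢ ¬̇ c) ∷ []) (Γ ⊢ ¬̇ c′)
  conv-≐   : c ▷ c′ → RGA ((Γ ⊢ c′ 𝖭) ∷ []) (Γ ⊢ c ≐ c′)

  𝓡S : RGA ((Γ ⊢ m 𝖭) ∷ (Γ ⊢ (h · m · (𝓡 · g · h · m)) 𝖭) ∷ [])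
           (Γ ⊢ 𝓡 · g · h · (𝐒 m) ≐ h · m · (𝓡 · g · h · m))

  𝓐I₁ : RGA ((v 0 𝖭 ∷ map ↑ Γ ⊢ ↑ f · v 0) ∷ []) (Γ ⊢ 𝓐 · f)
  𝓐E₁ : RGA ((Γ ⊢ 𝓐 · f) ∷ (Γ ⊢ a 𝖭) ∷ []) (Γ ⊢ f · a)
  𝓐I₂ : RGA ((Γ ⊢ ¬̇ (f · a)) ∷ (Γ ⊢ a 𝖭) ∷ []) (Γ ⊢ ¬̇ (𝓐 · f))
  𝓐E₂ : RGA ((Γ ⊢ ¬̇ (𝓐 · f))
              ∷ (v 0 𝖭 ∷ ¬̇ (↑ f · v 0) ∷ map ↑ Γ ⊢ ↑ c) ∷ [])
            (Γ ⊢ c)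

data OGA : RuleSystem where
  rga : ∀ {ps j} → RGA ps j → OGA ps j
  ATI : OGA ((Γ ⊢ 𝓐 · (ƛ ((↑ u · v 0) 𝖡))) ∷ []) (Γ ⊢ (𝓐 · u) 𝖡)

-- Proofs are listed with the latest judgement first, so the tail of the list
-- holds the earlier entries.
data IsProof (R : RuleSystem) : List Judgement → Set where
  []   : IsProof R []
  step : ∀ {js ps j} → IsProof R js → All (_∈ js) ps → R ps j → IsProof R (j ∷ js)

Derivable : RuleSystem → Judgement → Set
Derivable R j = ∃ λ js → IsProof R js × j ∈ js

-- Primitive recursive definitions by arity.  Arity 0 is allowed: it is the
-- arity of the base case in a recursion without parameters.
data PR : ℕ → Set where
  zeroᵖ : ∀ n → PR n
  sucᵖ  : PR 1
  projᵖ : ∀ {n} → Fin n → PR n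
  compᵖ : ∀ {m n} → PR m → Vec (PR n) m → PR n
  recᵖ  : ∀ {n} → PR n → PR (2 + n) → PR (1 + n)

mutual
  ⟦_⟧ : ∀ {n} → PR n → Vec ℕ n → ℕ
  ⟦ zeroᵖ n ⟧    xs       = 0
  ⟦ sucᵖ ⟧       (x ∷ []) = suc x
  ⟦ projᵖ i ⟧    xs       = Vec.lookup xs i
  ⟦ compᵖ g hs ⟧ xs       = ⟦ g ⟧ (⟦ hs ⟧* xs)
  ⟦ recᵖ g h ⟧   (y ∷ xs) = recVal g h xs y

  ⟦_⟧* : ∀ {m n} → Vec (PR n) m → Vec ℕ n → Vec ℕ m
  ⟦ [] ⟧*     xs = []
  ⟦ h ∷ hs ⟧* xs = ⟦ h ⟧ xs ∷ ⟦ hs ⟧* xs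

  recVal : ∀ {n} → PR n → PR (2 + n) → Vec ℕ n → ℕ → ℕ
  recVal g h xs zero    = ⟦ g ⟧ xs
  recVal g h xs (suc y) = ⟦ h ⟧ (y ∷ recVal g h xs y ∷ xs)

record StepFunction : Set where
  field
    fun      : ℕ → ℕ → ℕ
    def      : PR 2
    presents : ∀ n k → ⟦ def ⟧ (n ∷ k ∷ []) ≡ fun n k

lams : ℕ → Term → Term
lams zero    t = t
lams (suc n) t = ƛ (lams n t)

apps : Term → List Term → Term
apps = foldl _·_

-- The arguments x₁ … xₙ bound by n consecutive λs, seen from under k further
-- λs: v (n - 1 + k), …, v k, since the first argument is bound outermost.
args : ℕ → ℕ → List Term
args k n = applyDownFrom (λ i → v (i + k)) n

-- Compiled terms are closed, so they are placed under λs without shifting.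
mutual
  compile : ∀ {n} → PR n → Term
  compile (zeroᵖ n)            = lams n 𝟎
  compile sucᵖ                 = ƛ 𝐒 (v 0)
  compile (projᵖ {n} i)        = lams n (v (toℕ (opposite i)))
  compile (compᵖ {n = n} g hs) = lams n (apps (compile g) (compile* hs (args 0 n)))
  compile (recᵖ {n} g h)       =
    lams (1 + n)
      (𝓡 · apps (compile g) (args 0 n)
         · (ƛ ƛ apps (compile h · v 1 · v 0) (args 2 n))
         · v n)

  compile* : ∀ {m n} → Vec (PR n) m → List Term → List Term
  compile* []       xs = []
  compile* (h ∷ hs) xs = apps (compile h) xs ∷ compile* hs xs

cmp : StepFunction → Term
cmp f = compile (StepFunction.def f)

rrep : StepFunction → Term
rrep f = ƛ ¬̇ (𝓐 · (ƛ (cmp f · v 1 · v 0 ≐ 𝟎)))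

{-# OPTIONS --safe #-}
module Submission where

-- ATI reduces the decidability of 𝓐 · u to that of its instances at a variable.
-- It is used twice: the instances of the outer quantifier are, up to a head
-- step and a negation, the inner quantified sentences, and the instances of the
-- inner one are the equations cmp f · n · k = 0.  Equations between numbers are
-- decidable, so all that remains is that a compiled primitive recursive
-- definition provably sends numbers to numbers; this goes by recursion on the
-- definition, with the induction rule for primitive recursion.

open import Defs
open import Data.Bool using (true; false; if_then_else_)
open import Data.Bool.Properties using (T-≡)
open import Data.Empty using (⊥-elim)
open import Data.Fin using (zero; suc; toℕ; opposite)
open import Data.Fin.Properties using (toℕ-fromℕ; toℕ-inject₁; toℕ<n)
open import Data.List using (List; []; _∷_; map; _++_)
open import Data.List.Membership.Propositional using (_∈_)
open import Data.List.Membership.Propositional.Properties using (∈-++⁺ˡ; ∈-++⁺ʳ)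
open import Data.List.Relation.Unary.All as All using (All; []; _∷_)
open import Data.List.Relation.Unary.Any using (here)
open import Data.Nat using (ℕ; zero; suc; _+_; _≤_; _<_; _⊔_; _≡ᵇ_; z≤n; s≤s; s≤s⁻¹; pred)
open import Data.Nat.Properties
  using (≡⇒≡ᵇ; ≡ᵇ⇒≡; ≤-refl; ≤-reflexive; ≤-trans; <-irrefl; n≮0; n≤1+n; pred-mono-≤;
         +-comm; +-suc; +-identityʳ; m≤m+n; m≤m⊔n; m≤n⊔m; m≤n⇒m≤n⊔o; m≤n⇒m≤o⊔n)
open import Data.Product using (_×_; ∃; _,_)
open import Data.Sum using (inj₁; inj₂)
open import Data.Vec as Vec using (Vec; []; _∷_; toList)
open import Data.Vec.Relation.Unary.All as VAll using ([]; _∷_)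
open import Data.Vec.Relation.Unary.All.Properties using (lookup⁺)
open import Function using (_∘_)
open import Function.Bundles using (Equivalence)
open import Relation.Binary.Construct.Closure.ReflexiveTransitive using (Star; ε; _◅_)
open import Relation.Binary.PropositionalEquality
  using (_≡_; refl; sym; trans; cong; cong₂)
  renaming (subst to transport)
open import Relation.Nullary using (¬_)

private
  variable
    Γ : Context
    a b c c′ x y : Term
    j k n : ℕ
    ρ : ℕ → ℕ
    σ τ : ℕ → Term

-- Fusion laws for renaming and substitution

rename-∘ : ∀ {ρ ρ′ ρ″} → (∀ i → ρ′ (ρ i) ≡ ρ″ i) →
           ∀ t → rename ρ′ (rename ρ t) ≡ rename ρ″ t
rename-∘ eq (v i)   = cong v (eq i)
rename-∘ eq ⊥̇       = refl
rename-∘ eq 𝟎       = refl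
rename-∘ eq (𝐒 t)   = cong 𝐒_ (rename-∘ eq t)
rename-∘ eq (t ≐ u) = cong₂ _≐_ (rename-∘ eq t) (rename-∘ eq u)
rename-∘ eq (¬̇ t)   = cong ¬̇_ (rename-∘ eq t)
rename-∘ eq (t ∨̇ u) = cong₂ _∨̇_ (rename-∘ eq t) (rename-∘ eq u)
rename-∘ eq (ƛ b)   = cong ƛ_ (rename-∘ (λ { zero → refl ; (suc i) → cong suc (eq i) }) b)
rename-∘ eq (t · u) = cong₂ _·_ (rename-∘ eq t) (rename-∘ eq u)
rename-∘ eq 𝓡       = refl
rename-∘ eq 𝓐       = refl

subst-rename : (∀ i → τ (ρ i) ≡ σ i) → ∀ t → subst τ (rename ρ t) ≡ subst σ t
subst-rename eq (v i)   = eq i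
subst-rename eq ⊥̇       = refl
subst-rename eq 𝟎       = refl
subst-rename eq (𝐒 t)   = cong 𝐒_ (subst-rename eq t)
subst-rename eq (t ≐ u) = cong₂ _≐_ (subst-rename eq t) (subst-rename eq u)
subst-rename eq (¬̇ t)   = cong ¬̇_ (subst-rename eq t)
subst-rename eq (t ∨̇ u) = cong₂ _∨̇_ (subst-rename eq t) (subst-rename eq u)
subst-rename eq (ƛ b)   = cong ƛ_ (subst-rename (λ { zero → refl ; (suc i) → cong ↑ (eq i) }) b)
subst-rename eq (t · u) = cong₂ _·_ (subst-rename eq t) (subst-rename eq u)
subst-rename eq 𝓡       = refl
subst-rename eq 𝓐       = refl

-- Both sides fuse to the renaming `suc ∘ ρ`. This carries `rename-subst` under a binder, as
-- `↑-subst` does for `subst-∘`.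
↑-rename : ∀ t → rename (liftRen ρ) (↑ t) ≡ ↑ (rename ρ t)
↑-rename t = trans (rename-∘ (λ _ → refl) t) (sym (rename-∘ (λ _ → refl) t))

rename-subst : (∀ i → rename ρ (σ i) ≡ τ i) → ∀ t → rename ρ (subst σ t) ≡ subst τ t
rename-subst eq (v i)   = eq i
rename-subst eq ⊥̇       = refl
rename-subst eq 𝟎       = refl
rename-subst eq (𝐒 t)   = cong 𝐒_ (rename-subst eq t)
rename-subst eq (t ≐ u) = cong₂ _≐_ (rename-subst eq t) (rename-subst eq u)
rename-subst eq (¬̇ t)   = cong ¬̇_ (rename-subst eq t)
rename-subst eq (t ∨̇ u) = cong₂ _∨̇_ (rename-subst eq t) (rename-subst eq u)
rename-subst {σ = σ} eq (ƛ b) =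
  cong ƛ_ (rename-subst (λ { zero → refl ; (suc i) → trans (↑-rename (σ i)) (cong ↑ (eq i)) }) b)
rename-subst eq (t · u) = cong₂ _·_ (rename-subst eq t) (rename-subst eq u)
rename-subst eq 𝓡       = refl
rename-subst eq 𝓐       = refl

↑-subst : ∀ t → subst (liftSub σ) (↑ t) ≡ ↑ (subst σ t)
↑-subst t = trans (subst-rename (λ _ → refl) t) (sym (rename-subst (λ _ → refl) t))

subst-∘ : ∀ {υ} → (∀ i → subst τ (σ i) ≡ υ i) → ∀ t → subst τ (subst σ t) ≡ subst υ t
subst-∘ eq (v i)   = eq i
subst-∘ eq ⊥̇       = refl
subst-∘ eq 𝟎       = refl
subst-∘ eq (𝐒 t)   = cong 𝐒_ (subst-∘ eq t)
subst-∘ eq (t ≐ u) = cong₂ _≐_ (subst-∘ eq t) (subst-∘ eq u)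
subst-∘ eq (¬̇ t)   = cong ¬̇_ (subst-∘ eq t)
subst-∘ eq (t ∨̇ u) = cong₂ _∨̇_ (subst-∘ eq t) (subst-∘ eq u)
subst-∘ {σ = σ} eq (ƛ b) =
  cong ƛ_ (subst-∘ (λ { zero → refl ; (suc i) → trans (↑-subst (σ i)) (cong ↑ (eq i)) }) b)
subst-∘ eq (t · u) = cong₂ _·_ (subst-∘ eq t) (subst-∘ eq u)
subst-∘ eq 𝓡       = refl
subst-∘ eq 𝓐       = refl

-- Constraining `σ` on free variables only lets this serve fresh variables and closed compiled terms
-- alike.
subst-fixed : ∀ t → (∀ i → i ∈fv t → σ i ≡ v i) → subst σ t ≡ t
subst-fixed (v i)   eq = eq i refl
subst-fixed ⊥̇       eq = refl
subst-fixed 𝟎       eq = refl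
subst-fixed (𝐒 t)   eq = cong 𝐒_ (subst-fixed t eq)
subst-fixed (t ≐ u) eq = cong₂ _≐_ (subst-fixed t (λ i → eq i ∘ inj₁)) (subst-fixed u (λ i → eq i ∘ inj₂))
subst-fixed (¬̇ t)   eq = cong ¬̇_ (subst-fixed t eq)
subst-fixed (t ∨̇ u) eq = cong₂ _∨̇_ (subst-fixed t (λ i → eq i ∘ inj₁)) (subst-fixed u (λ i → eq i ∘ inj₂))
subst-fixed (ƛ b)   eq = cong ƛ_ (subst-fixed b λ { zero _ → refl ; (suc i) i∈b → cong ↑ (eq i i∈b) })
subst-fixed (t · u) eq = cong₂ _·_ (subst-fixed t (λ i → eq i ∘ inj₁)) (subst-fixed u (λ i → eq i ∘ inj₂))
subst-fixed 𝓡       eq = refl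
subst-fixed 𝓐       eq = refl

subst-id : ∀ t → subst v t ≡ t
subst-id t = subst-fixed t λ _ _ → refl

-- Free variables

Below : ℕ → Term → Set
Below k t = ∀ i → i ∈fv t → i < k

Below-mono : ∀ t → j ≤ k → Below j t → Below k t
Below-mono t j≤k t<j i i∈t = ≤-trans (t<j i i∈t) j≤k

fvBound : Term → ℕ
fvBound (v i)   = suc i
fvBound ⊥̇       = 0
fvBound 𝟎       = 0
fvBound (𝐒 t)   = fvBound t
fvBound (t ≐ u) = fvBound t ⊔ fvBound u
fvBound (¬̇ t)   = fvBound t
fvBound (t ∨̇ u) = fvBound t ⊔ fvBound u
fvBound (ƛ b)   = pred (fvBound b)
fvBound (t · u) = fvBound t ⊔ fvBound u
fvBound 𝓡       = 0
fvBound 𝓐       = 0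

below-fvBound : ∀ t → Below (fvBound t) t
below-fvBound (v i)   _ refl     = ≤-refl
below-fvBound (𝐒 t)   i p        = below-fvBound t i p
below-fvBound (t ≐ u) i (inj₁ p) = m≤n⇒m≤n⊔o _ (below-fvBound t i p)
below-fvBound (t ≐ u) i (inj₂ p) = m≤n⇒m≤o⊔n _ (below-fvBound u i p)
below-fvBound (¬̇ t)   i p        = below-fvBound t i p
below-fvBound (t ∨̇ u) i (inj₁ p) = m≤n⇒m≤n⊔o _ (below-fvBound t i p)
below-fvBound (t ∨̇ u) i (inj₂ p) = m≤n⇒m≤o⊔n _ (below-fvBound u i p)
below-fvBound (ƛ b)   i p        = pred-mono-≤ (below-fvBound b (suc i) p)
below-fvBound (t · u) i (inj₁ p) = m≤n⇒m≤n⊔o _ (below-fvBound t i p)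
below-fvBound (t · u) i (inj₂ p) = m≤n⇒m≤o⊔n _ (below-fvBound u i p)

fvBounds : ∀ ts → ∃ λ k → All (Below k) ts
fvBounds []       = 0 , []
fvBounds (t ∷ ts) with k , ts<k ← fvBounds ts =
  fvBound t ⊔ k
  , Below-mono t (m≤m⊔n _ k) (below-fvBound t)
  ∷ All.map (λ {u} → Below-mono u (m≤n⊔m (fvBound t) k)) ts<k

-- The rules `≐-repl` and `ind` mark the places to be replaced by a variable. One that is foreign to
-- the surrounding terms marks the intended places alone.
fresh : ∀ ts → ∃ λ i → All (λ t → ¬ (i ∈fv t)) ts
fresh ts with k , ts<k ← fvBounds ts = k , All.map (λ t<k k∈t → <-irrefl refl (t<k k k∈t)) ts<k

≡ᵇ-refl : ∀ i → (i ≡ᵇ i) ≡ true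
≡ᵇ-refl i = Equivalence.to T-≡ (≡⇒≡ᵇ i i refl)

↦-hit : ∀ i s → [ i ↦ s ] (v i) ≡ s
↦-hit i s rewrite ≡ᵇ-refl i = refl

↦-fresh : ∀ i s t → ¬ (i ∈fv t) → [ i ↦ s ] t ≡ t
↦-fresh i s t i∉t = subst-fixed t miss
  where
  miss : ∀ j → j ∈fv t → (if j ≡ᵇ i then s else v j) ≡ v j
  miss j j∈t with j ≡ᵇ i in eq
  ... | false = refl
  ... | true with refl ← ≡ᵇ⇒≡ j i (Equivalence.from T-≡ eq) = ⊥-elim (i∉t j∈t)

-- Closedness of compiled definitions

Below-lams : ∀ n t → Below (n + k) t → Below k (lams n t)
Below-lams zero    t t<k = t<k
Below-lams (suc n) t t<k i i∈ =
  s≤s⁻¹ (Below-lams n t (λ j j∈t → transport (j <_) (sym (+-suc n _)) (t<k j j∈t)) (suc i) i∈)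

Below-apps : ∀ t ts → Below k t → All (Below k) ts → Below k (apps t ts)
Below-apps t []       t<k []           = t<k
Below-apps t (u ∷ ts) t<k (u<k ∷ ts<k) =
  Below-apps (t · u) ts (λ { i (inj₁ p) → t<k i p ; i (inj₂ p) → u<k i p }) ts<k

Below-args : ∀ k n → n + k ≤ j → All (Below j) (args k n)
Below-args k zero    n+k≤j = []
Below-args k (suc n) n+k≤j =
  (λ { _ refl → n+k≤j }) ∷ Below-args k n (≤-trans (n≤1+n _) n+k≤j)

mutual
  compile-closed : (f : PR n) → Below 0 (compile f)
  compile-closed (zeroᵖ n)            = Below-lams n 𝟎 λ _ ()
  compile-closed sucᵖ                 = λ { _ () }
  compile-closed (projᵖ {n} i)        =
    Below-lams n (v _) λ { _ refl → ≤-trans (toℕ<n (opposite i)) (m≤m+n n 0) }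
  compile-closed (compᵖ {n = n} g hs) =
    Below-lams n _ (Below-apps (compile g) _ (compile-below g)
      (compile*-below hs (Below-args 0 n ≤-refl)))
  compile-closed (recᵖ {n} g h)       = Below-lams (suc n) _ λ where
    i (inj₁ (inj₁ (inj₂ p))) →
      Below-apps (compile g) _ (compile-below g) (Below-args 0 n (n≤1+n _)) i p
    i (inj₁ (inj₂ p)) →
      -- The two `ƛ`s of the step term raise index and bound by two; both are lowered again here.
      s≤s⁻¹ (s≤s⁻¹ (Below-apps (compile h · v 1 · v 0) _
        (λ { j (inj₁ (inj₁ q))    → compile-below h j q
           ; _ (inj₁ (inj₂ refl)) → s≤s (s≤s z≤n)
           ; _ (inj₂ refl)        → s≤s z≤n })
        (Below-args 2 n (≤-trans (≤-reflexive (+-comm n 2))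
          (s≤s (s≤s (≤-trans (m≤m+n n 0) (n≤1+n _)))))) _ p))
    _ (inj₂ refl) → s≤s (m≤m+n n 0)

  compile-below : (f : PR n) → Below k (compile f)
  compile-below f = Below-mono (compile f) z≤n (compile-closed f)

  compile*-below : ∀ {m} (hs : Vec (PR n) m) {ts} → All (Below k) ts → All (Below k) (compile* hs ts)
  compile*-below []       ts<k = []
  compile*-below (h ∷ hs) ts<k =
    Below-apps (compile h) _ (compile-below h) ts<k ∷ compile*-below hs ts<k

subst-compile : (f : PR n) → subst σ (compile f) ≡ compile f
subst-compile f = subst-fixed (compile f) λ i i∈f → ⊥-elim (n≮0 (compile-closed f i i∈f))

-- Head reduction of curried applications

infixl 5 _,,_ _,,*_

_,,_ : (ℕ → Term) → Term → ℕ → Term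
(σ ,, x) zero    = x
(σ ,, x) (suc i) = σ i

-- The last entry ends up at index 0, since the first argument of a curried term is bound outermost.
_,,*_ : (ℕ → Term) → Vec Term n → ℕ → Term
σ ,,* []       = σ
σ ,,* (x ∷ xs) = σ ,, x ,,* xs

infix 4 _▷*_

_▷*_ : Term → Term → Set
_▷*_ = Star _▷_

▷-apps : ∀ ts → c ▷ c′ → apps c ts ▷ apps c′ ts
▷-apps []       r = r
▷-apps (t ∷ ts) r = ▷-apps ts (appˡ r)

subst-β : ∀ b → subst (liftSub σ) b [ x ] ≡ subst (σ ,, x) b
subst-β {σ} = subst-∘ λ { zero → refl
                        ; (suc i) → trans (subst-rename (λ _ → refl) (σ i)) (subst-id (σ i)) }

β-subst : ∀ b → (ƛ subst (liftSub σ) b) · x ▷ subst (σ ,, x) b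
β-subst {σ} {x} b = transport ((ƛ subst (liftSub σ) b) · x ▷_) (subst-β b) β

-- Each β-step leaves a substitution pending over the remaining `ƛ`s, so the induction needs an
-- arbitrary `σ`.
apps-lams : ∀ σ t (xs : Vec Term n) →
            apps (subst σ (lams n t)) (toList xs) ▷* subst (σ ,,* xs) t
apps-lams σ t []                     = ε
apps-lams {suc n} σ t (x ∷ xs) =
  ▷-apps (toList xs) (β-subst (lams n t)) ◅ apps-lams (σ ,, x) t xs

apps-lams-id : ∀ t (xs : Vec Term n) →
               apps (lams n t) (toList xs) ▷* subst (v ,,* xs) t
apps-lams-id {n} t xs =
  transport (λ s → apps s (toList xs) ▷* subst (v ,,* xs) t) (subst-id (lams n t)) (apps-lams v t xs)

-- Instantiating with `v 0` undoes the shift under the binder. The premises of `𝓐I₁` and `ATI` have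
-- the shape on the left.
↑ƛ-▷ : ∀ b → ↑ (ƛ b) · v 0 ▷ b
↑ƛ-▷ b = transport (↑ (ƛ b) · v 0 ▷_)
  (trans (subst-rename (λ { zero → refl ; (suc i) → refl }) b) (subst-id b)) β

,,*-+ : ∀ σ (xs : Vec Term n) i → (σ ,,* xs) (n + i) ≡ σ i
,,*-+         σ []       i = refl
,,*-+ {suc n} σ (x ∷ xs) i =
  trans (cong (σ ,, x ,,* xs) (sym (+-suc n i))) (,,*-+ (σ ,, x) xs (suc i))

-- Positions count from the front of the vector and indices from its back, whence `opposite`.
,,*-lookup : ∀ σ (xs : Vec Term n) i → (σ ,,* xs) (toℕ (opposite i)) ≡ Vec.lookup xs i
,,*-lookup {suc n} σ (x ∷ xs) zero =
  trans (cong (σ ,, x ,,* xs) (trans (toℕ-fromℕ n) (sym (+-identityʳ n)))) (,,*-+ (σ ,, x) xs 0)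
,,*-lookup σ (x ∷ xs) (suc i) =
  trans (cong (σ ,, x ,,* xs) (toℕ-inject₁ (opposite i))) (,,*-lookup (σ ,, x) xs i)

-- The offset `k` covers both uses: 0 directly under the argument binders, 2 inside the step term of
-- a recursion.
subst-args : ∀ k σ (xs : Vec Term n) → (∀ i → τ (i + k) ≡ (σ ,,* xs) i) →
             map (subst τ) (args k n) ≡ toList xs
subst-args k σ []                 eq = refl
subst-args {suc n} k σ (x ∷ xs) eq = cong₂ _∷_
  (trans (eq n) (trans (cong (σ ,, x ,,* xs) (sym (+-identityʳ n))) (,,*-+ (σ ,, x) xs 0)))
  (subst-args k (σ ,, x) xs eq)

subst-args₀ : ∀ σ (xs : Vec Term n) → map (subst (σ ,,* xs)) (args 0 n) ≡ toList xs
subst-args₀ σ xs = subst-args 0 σ xs λ i → cong (σ ,,* xs) (+-identityʳ i)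

subst-args₂ : ∀ σ (xs : Vec Term n) {x y} →
              map (subst (σ ,,* xs ,, x ,, y)) (args 2 n) ≡ toList xs
subst-args₂ σ xs = subst-args 2 σ xs λ i → cong (σ ,,* xs ,, _ ,, _) (+-comm i 2)

subst-apps : ∀ t ts → subst σ (apps t ts) ≡ apps (subst σ t) (map (subst σ) ts)
subst-apps t []       = refl
subst-apps t (u ∷ ts) = subst-apps (t · u) ts

subst-apps-compile : (f : PR n) → ∀ ts {us} → map (subst σ) ts ≡ us →
                     subst σ (apps (compile f) ts) ≡ apps (compile f) us
subst-apps-compile f ts refl =
  trans (subst-apps (compile f) ts) (cong (λ t → apps t (map _ ts)) (subst-compile f))

compile*-terms : ∀ {m} → Vec (PR n) m → List Term → Vec Term m
compile*-terms hs ts = Vec.map (λ h → apps (compile h) ts) hs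

subst-compile* : ∀ {m} (hs : Vec (PR n) m) ts {us} → map (subst σ) ts ≡ us →
                 map (subst σ) (compile* hs ts) ≡ toList (compile*-terms hs us)
subst-compile* []       ts eq = refl
subst-compile* (h ∷ hs) ts eq = cong₂ _∷_ (subst-apps-compile h ts eq) (subst-compile* hs ts eq)

-- Derivability

infix 3 _⊩_

_⊩_ : Context → Term → Set
Γ ⊩ c = Derivable OGA (Γ ⊢ c)

module _ {R : RuleSystem} where

  ++-isProof : ∀ {js ks} → IsProof R js → IsProof R ks → IsProof R (js ++ ks)
  ++-isProof []             q = q
  ++-isProof (step p ps∈ r) q = step (++-isProof p q) (All.map ∈-++⁺ˡ ps∈) r

  collect : ∀ {ps} → All (Derivable R) ps → ∃ λ js → IsProof R js × All (_∈ js) ps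
  collect []                    = [] , [] , []
  collect ((js , p , j∈) ∷ ds) with ks , q , ps∈ ← collect ds =
    js ++ ks , ++-isProof p q , ∈-++⁺ˡ j∈ ∷ All.map (∈-++⁺ʳ js) ps∈

  -- Concatenated proofs form a proof, so those of all premises merge into one list, to which the
  -- conclusion is added. From here on derivations compose like trees.
  derive : ∀ {ps j} → R ps j → All (Derivable R) ps → Derivable R j
  derive r ds with js , p , ps∈ ← collect ds = _ , step p ps∈ r , here refl

by : ∀ {ps c} → RGA ps (Γ ⊢ c) → All (Derivable OGA) ps → Γ ⊩ c
by r = derive (rga r)

-- Rewrites `b` to `a` in the predicate `v i ≐ c`, with `i` fresh for `c`.
≐-trans : Γ ⊩ a ≐ b → Γ ⊩ b ≐ c → Γ ⊩ a ≐ c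
≐-trans {Γ} {a} {b} {c} a≐b b≐c with i , i∉c ∷ [] ← fresh (c ∷ []) =
  transport (Γ ⊩_) (inst-eq a)
    (by (≐-repl i (v i ≐ c))
      (by ≐-sym (a≐b ∷ []) ∷ transport (Γ ⊩_) (sym (inst-eq b)) b≐c ∷ []))
  where
  inst-eq : ∀ s → [ i ↦ s ] (v i ≐ c) ≡ s ≐ c
  inst-eq s = cong₂ _≐_ (↦-hit i s) (↦-fresh i s c i∉c)

≐⇒𝖭ˡ : Γ ⊩ a ≐ b → Γ ⊩ a 𝖭
≐⇒𝖭ˡ a≐b = ≐-trans a≐b (by ≐-sym (a≐b ∷ []))

▷-𝖭 : c ▷ c′ → Γ ⊩ c′ 𝖭 → Γ ⊩ c 𝖭
▷-𝖭 r c′𝖭 = ≐⇒𝖭ˡ (by (conv-≐ r) (c′𝖭 ∷ []))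

▷*-𝖭 : c ▷* c′ → Γ ⊩ c′ 𝖭 → Γ ⊩ c 𝖭
▷*-𝖭 ε        c′𝖭 = c′𝖭
▷*-𝖭 (r ◅ rs) c′𝖭 = ▷-𝖭 r (▷*-𝖭 rs c′𝖭)

-- `conv-¬` goes only from redex to reduct. For the converse, `¬̇ c′` gives `c′ ≐ 𝟎`, so `c′` is a
-- number; then `conv-≐` yields `c ≐ c′`, hence `c ≐ 𝟎`.
▷-¬ : c ▷ c′ → Γ ⊩ ¬̇ c′ → Γ ⊩ ¬̇ c
▷-¬ r ¬c′ = by ≐0⇒false (≐-trans (by (conv-≐ r) (≐⇒𝖭ˡ c′≐0 ∷ [])) c′≐0 ∷ [])
  where c′≐0 = by false⇒≐0 (¬c′ ∷ [])

▷-𝖡 : c ▷ c′ → Γ ⊩ c′ 𝖡 → Γ ⊩ c 𝖡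
▷-𝖡 r c′𝖡 = by ∨E₁
  ( c′𝖡
  ∷ by ∨I₁ (by (conv-exp r) (by hyp [] ∷ []) ∷ [])
  ∷ by ∨I₂ (▷-¬ r (by hyp []) ∷ [])
  ∷ [])

¬-𝖡 : Γ ⊩ a 𝖡 → Γ ⊩ (¬̇ a) 𝖡
¬-𝖡 a𝖡 = by ∨E₁
  ( a𝖡
  ∷ by ∨I₂ (by ¬¬I (by hyp [] ∷ []) ∷ [])
  ∷ by ∨I₁ (by hyp [] ∷ [])
  ∷ [])

-- `ATI` with `u = ƛ b`. One head step opens the abstraction over the decidability claim, a second
-- opens `ƛ b` inside it.
𝓐ƛ-𝖡 : v 0 𝖭 ∷ map ↑ Γ ⊩ b 𝖡 → Γ ⊩ (𝓐 · (ƛ b)) 𝖡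
𝓐ƛ-𝖡 {b = b} b𝖡 =
  derive ATI (by 𝓐I₁ (by (conv-exp (↑ƛ-▷ _)) (▷-𝖡 (↑ƛ-▷ b) b𝖡 ∷ []) ∷ []) ∷ [])

-- Induction inside the calculus on the recursion argument. The hypothesis on `h` ranges over
-- contexts `Δ` because the induction step works under two additional assumptions.
𝓡-𝖭 : ∀ g h → Γ ⊩ g 𝖭 →
      (∀ {Δ} m r → (∀ {t} → Γ ⊩ t 𝖭 → Δ ⊩ t 𝖭) → Δ ⊩ m 𝖭 → Δ ⊩ r 𝖭 → Δ ⊩ (h · m · r) 𝖭) →
      Γ ⊩ y 𝖭 → Γ ⊩ (𝓡 · g · h · y) 𝖭
𝓡-𝖭 {Γ} {y} g h g𝖭 h𝖭 y𝖭 with i , i∉g ∷ i∉h ∷ i∉Γ ← fresh (g ∷ h ∷ Γ) =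
  transport (Γ ⊩_) (inst-eq y)
    (by (ind i (R (v i) 𝖭) i∉Γ)
      ( transport (Γ ⊩_) (sym (inst-eq 𝟎)) (▷-𝖭 rec0 g𝖭)
      ∷ transport (v i 𝖭 ∷ R (v i) 𝖭 ∷ Γ ⊩_) (sym (inst-eq (𝐒 (v i))))
          -- `recS` reduces at numerals only, so at the open term `𝐒 (v i)` the recursor is unfolded
          -- by `𝓡S`.
          (≐⇒𝖭ˡ (by 𝓡S (m𝖭 ∷ h𝖭 (v i) (R (v i)) weaken₂ m𝖭 r𝖭 ∷ [])))
      ∷ y𝖭 ∷ []))
  where
  R : Term → Term
  R m = 𝓡 · g · h · m

  inst-eq : ∀ s → [ i ↦ s ] (R (v i) 𝖭) ≡ R s 𝖭
  inst-eq s rewrite ↦-fresh i s g i∉g | ↦-fresh i s h i∉h | ↦-hit i s = refl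

  weaken₂ : ∀ {t} → Γ ⊩ t 𝖭 → v i 𝖭 ∷ R (v i) 𝖭 ∷ Γ ⊩ t 𝖭
  weaken₂ t𝖭 = by weaken (by weaken (t𝖭 ∷ []) ∷ [])

  m𝖭 : v i 𝖭 ∷ R (v i) 𝖭 ∷ Γ ⊩ v i 𝖭
  m𝖭 = by hyp []

  r𝖭 : v i 𝖭 ∷ R (v i) 𝖭 ∷ Γ ⊩ R (v i) 𝖭
  r𝖭 = by weaken (by hyp [] ∷ [])

-- Compiled definitions send numbers to numbers

mutual
  -- Arguments are arbitrary, possibly open terms and `Γ` varies: in the recursion case `h` is
  -- applied to an induction variable in an extended context.
  compile-𝖭 : (f : PR n) (xs : Vec Term n) → VAll.All (λ x → Γ ⊩ x 𝖭) xs →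
              Γ ⊩ apps (compile f) (toList xs) 𝖭
  compile-𝖭 (zeroᵖ n) xs xs𝖭 = ▷*-𝖭 (apps-lams-id 𝟎 xs) (by 0𝖭 [])
  compile-𝖭 sucᵖ (x ∷ []) (x𝖭 ∷ []) = ▷-𝖭 β (by S𝖭I (x𝖭 ∷ []))
  compile-𝖭 {Γ = Γ} (projᵖ i) xs xs𝖭 =
    ▷*-𝖭 (apps-lams-id (v (toℕ (opposite i))) xs)
      (transport (λ t → Γ ⊩ t 𝖭) (sym (,,*-lookup v xs i)) (lookup⁺ xs𝖭 i))
  compile-𝖭 {Γ = Γ} (compᵖ {n = n} g hs) xs xs𝖭 =
    ▷*-𝖭 (apps-lams-id (apps (compile g) (compile* hs (args 0 n))) xs)
      (transport (λ t → Γ ⊩ t 𝖭)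
        (sym (subst-apps-compile g _ (subst-compile* hs (args 0 n) (subst-args₀ v xs))))
        (compile-𝖭 g _ (compile*-𝖭 hs xs xs𝖭)))
  compile-𝖭 {Γ = Γ} (recᵖ {n} g h) (y ∷ xs) (y𝖭 ∷ xs𝖭) =
    ▷*-𝖭 (apps-lams-id _ (y ∷ xs)) (𝓡-𝖭 _ _ base step-𝖭 at-y)
    where
    -- The recursion argument is bound outermost, so it is pushed before the parameters.
    σ₀ = v ,, y

    base : Γ ⊩ subst (σ₀ ,,* xs) (apps (compile g) (args 0 n)) 𝖭
    base = transport (λ t → Γ ⊩ t 𝖭)
      (sym (subst-apps-compile g (args 0 n) (subst-args₀ σ₀ xs)))
      (compile-𝖭 g xs xs𝖭)

    body : Term
    body = apps (compile h · v 1 · v 0) (args 2 n)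

    step-𝖭 : ∀ {Δ} m r → (∀ {t} → Γ ⊩ t 𝖭 → Δ ⊩ t 𝖭) → Δ ⊩ m 𝖭 → Δ ⊩ r 𝖭 →
             Δ ⊩ (subst (σ₀ ,,* xs) (ƛ ƛ body) · m · r) 𝖭
    step-𝖭 {Δ} m r Γ⇒Δ m𝖭 r𝖭 =
      -- The step term still carries the substitution for `y` and `xs`; two more β-steps add `m` and
      -- `r`, leaving `h` applied to `m`, `r`, `xs`.
      ▷*-𝖭 (apps-lams (σ₀ ,,* xs) body (m ∷ r ∷ []))
        (transport (λ t → Δ ⊩ t 𝖭)
          (sym (subst-apps-compile h (v 1 ∷ v 0 ∷ args 2 n)
            (cong (λ ts → m ∷ r ∷ ts) (subst-args₂ σ₀ xs))))
          (compile-𝖭 h (m ∷ r ∷ xs) (m𝖭 ∷ r𝖭 ∷ VAll.map Γ⇒Δ xs𝖭)))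

    -- Index `n` lies just past the `n` parameters, where `y` was pushed.
    at-y : Γ ⊩ (σ₀ ,,* xs) n 𝖭
    at-y = transport (λ t → Γ ⊩ t 𝖭)
      (sym (trans (cong (σ₀ ,,* xs) (sym (+-identityʳ n))) (,,*-+ σ₀ xs 0))) y𝖭

  compile*-𝖭 : ∀ {m} (hs : Vec (PR n) m) (xs : Vec Term n) → VAll.All (λ x → Γ ⊩ x 𝖭) xs →
               VAll.All (λ x → Γ ⊩ x 𝖭) (compile*-terms hs (toList xs))
  compile*-𝖭 []       xs xs𝖭 = []
  compile*-𝖭 (h ∷ hs) xs xs𝖭 = compile-𝖭 h xs xs𝖭 ∷ compile*-𝖭 hs xs xs𝖭

theorem4p3 : (f : StepFunction) → Derivable OGA ([] ⊢ (𝓐 · rrep f) 𝖡)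
theorem4p3 f = 𝓐ƛ-𝖡 (¬-𝖡 (𝓐ƛ-𝖡 (by ≐-𝖡 (cmp-𝖭 ∷ by 0𝖭 [] ∷ []))))
  where
  -- `v 1` is the search input, shifted up by the inner quantifier, and `v 0` is the search step.
  cmp-𝖭 : v 0 𝖭 ∷ v 1 𝖭 ∷ [] ⊩ (cmp f · v 1 · v 0) 𝖭
  cmp-𝖭 = compile-𝖭 (StepFunction.def f) (v 1 ∷ v 0 ∷ [])
    (by weaken (by hyp [] ∷ []) ∷ by hyp [] ∷ [])
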